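{- Let $T$ be a (finite, nonempty) tournament. The following are equivalent: 1. $T$ is diamond-free (no induced subgraph of $T$ is a diamond); 2. $T$ is locally transitive; 3. $T$ is totally decomposable with respect to bijoin decomposition; 4. $T$ can be obtained from a single vertex by a sequence of twin-extensions and antitwin-extensions.
   Context: For a tournament $T$ with vertex set $X$, $N^+(x)$ and $N^-(x)$ denote the out- and in-neighbourhoods of $x$. The standard homogeneous relation of $T$ is: for $x\in X$ and $u,v\in X\setminus\{x\}$, $H(x|uv)$ holds iff $u,v$ both lie in $N^+(x)$ or both lie in $N^-(x)$. A bijoin (umodule) of $T$ is a subset $U\subseteq X$ such that for all $u,u'\in U$ and all $x,x'\in X\setminus U$: $H(u|xx')\Leftrightarrow H(u'|xx')$. It is trivial if $|U|\le 1$ or $|U|\ge |X|-1$. $T$ is totally decomposable with respect to bijoin decomposition if every induced subtournament of $T$ with at least $4$ vertices has a non-trivial bijoin. A diamond is one of the two 4-vertex tournaments consisting of a directed 3-cycle together with a fourth vertex that either dominates all three vertices of the cycle or is dominated by all three. $T$ is locally transitive if for each vertex $x$ the subtournaments induced by $N^+(x)$ and by $N^-(x)$ are transitive. Two vertices $x,y$ are twins if $N^+(x)\setminus\{y\}=N^+(y)\setminus\{x\}$, and antitwins if $N^+(x)\setminus\{y\}=N^-(y)\setminus\{x\}$. A twin-extension (resp. antitwin-extension) of a vertex $x$ of a tournament consists in adding a new vertex $y$ so that the result is a tournament in which $y$ is a twin (resp. antitwin) of $x$ (the arc between $x$ and $y$ being oriented arbitrarily). -}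

module Defs where

open import Data.Fin.Base using (Fin)
open import Data.Fin.Subset as Subset using (Subset; ∣_∣)
open import Data.Nat.Base using (ℕ; suc; _≤_)
open import Data.Product.Base using (∃; _×_; proj₁)
open import Data.Sum.Base using (_⊎_)
open import Function.Base using (_on_; _∘_)
open import Function.Bundles using (_↣_; _⇔_; Injection)
open import Level using (0ℓ)
open import Relation.Binary.Core using (Rel)
open import Relation.Binary.Definitions using (Trichotomous; Transitive; Tri; tri<; tri≈; tri>)
open import Relation.Binary.PropositionalEquality using (_≡_; _≢_; cong)
open import Relation.Nullary.Negation using (¬_)
open import Relation.Unary using (Pred; _∈_; _∖_; _≐_; ｛_｝)

-- Trichotomy says that there are no loops and that any two distinct
-- vertices are joined by exactly one arc.

record Tournament (n : ℕ) : Set₁ where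
  field
    _⟶_     : Rel (Fin n) 0ℓ
    compare : Trichotomous _≡_ _⟶_

  N⁺ : Fin n → Pred (Fin n) 0ℓ
  N⁺ x y = x ⟶ y

  N⁻ : Fin n → Pred (Fin n) 0ℓ
  N⁻ x y = y ⟶ x

  -- H x u v is the homogeneous relation H(x|uv); it forces u ≢ x and v ≢ x,
  -- because x belongs to neither of its neighbourhoods.

  H : Fin n → Fin n → Fin n → Set
  H x u v = (u ∈ N⁺ x × v ∈ N⁺ x) ⊎ (u ∈ N⁻ x × v ∈ N⁻ x)

  IsBijoin : Subset n → Set
  IsBijoin U = ∀ {u u′ x x′} →
    u Subset.∈ U → u′ Subset.∈ U → x Subset.∉ U → x′ Subset.∉ U →
    H u x x′ ⇔ H u′ x x′

  Twins : Fin n → Fin n → Set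
  Twins x y = (N⁺ x ∖ ｛ y ｝) ≐ (N⁺ y ∖ ｛ x ｝)

  Antitwins : Fin n → Fin n → Set
  Antitwins x y = (N⁺ x ∖ ｛ y ｝) ≐ (N⁻ y ∖ ｛ x ｝)

  -- The subtournament induced by the vertices satisfying P is transitive.

  TransitiveOn : Pred (Fin n) 0ℓ → Set
  TransitiveOn P = Transitive {A = ∃ P} (_⟶_ on proj₁)

  LocallyTransitive : Set
  LocallyTransitive = ∀ x → TransitiveOn (N⁺ x) × TransitiveOn (N⁻ x)

open Tournament public
  using (LocallyTransitive; IsBijoin; Twins; Antitwins)

-- The subtournament of T induced by a k-element vertex set, presented through
-- an enumeration of that set by Fin k.

induced : ∀ {k n} → Tournament n → Fin k ↣ Fin n → Tournament k
induced T ι = record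
  { _⟶_     = _⟶_ on to
  ; compare = λ u v → reflect (compare (to u) (to v))
  }
  where
  open Tournament T
  open Injection ι using (to; injective)

  reflect : ∀ {u v} →
    Tri (to u ⟶ to v) (to u ≡ to v) (to v ⟶ to u) →
    Tri (to u ⟶ to v) (u ≡ v) (to v ⟶ to u)
  reflect (tri< a ¬b ¬c) = tri< a (¬b ∘ cong to) ¬c
  reflect (tri≈ ¬a b ¬c) = tri≈ ¬a (injective b) ¬c
  reflect (tri> ¬a ¬b c) = tri> ¬a (¬b ∘ cong to) c

-- The vertices a, b, c, d are automatically distinct, so they are all the
-- vertices of D.

IsDiamond : Tournament 4 → Set
IsDiamond D = ∃ λ a → ∃ λ b → ∃ λ c → ∃ λ d →
  (a ⟶ b × b ⟶ c × c ⟶ a) ×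
  ((d ⟶ a × d ⟶ b × d ⟶ c) ⊎ (a ⟶ d × b ⟶ d × c ⟶ d))
  where open Tournament D

DiamondFree : ∀ {n} → Tournament n → Set
DiamondFree {n} T = (ι : Fin 4 ↣ Fin n) → ¬ IsDiamond (induced T ι)

-- The second alternative is ∣ U ∣ ≥ n - 1.

Trivial : ∀ {n} → Subset n → Set
Trivial {n} U = ∣ U ∣ ≤ 1 ⊎ n ≤ suc ∣ U ∣

HasNontrivialBijoin : ∀ {n} → Tournament n → Set
HasNontrivialBijoin T = ∃ λ U → IsBijoin T U × ¬ Trivial U

TotallyDecomposable : ∀ {n} → Tournament n → Set
TotallyDecomposable {n} T =
  ∀ {k} → 4 ≤ k → (ι : Fin k ↣ Fin n) → HasNontrivialBijoin (induced T ι)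

-- T′ arises from T by adding one new vertex; old records where the vertices
-- of T sit in T′, so that the labels of T′ are arbitrary.

record OneVertexExtension {n} (T : Tournament n) (T′ : Tournament (suc n)) : Set where
  private
    module T  = Tournament T
    module T′ = Tournament T′
  field
    embedding : Fin n ↣ Fin (suc n)
    new       : Fin (suc n)

  old : Fin n → Fin (suc n)
  old = Injection.to embedding

  field
    new-fresh : ∀ v → old v ≢ new
    arcs      : ∀ u v → u T.⟶ v ⇔ old u T′.⟶ old v

open OneVertexExtension public using (old; new)

TwinExtension : ∀ {n} → Tournament n → Fin n → Tournament (suc n) → Set
TwinExtension T x T′ =
  ∃ λ (E : OneVertexExtension T T′) → Twins T′ (old E x) (new E)

AntitwinExtension : ∀ {n} → Tournament n → Fin n → Tournament (suc n) → Set
AntitwinExtension T x T′ =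
  ∃ λ (E : OneVertexExtension T T′) → Antitwins T′ (old E x) (new E)

data ObtainableFromVertex : ∀ {n} → Tournament n → Set₁ where
  single   : (T : Tournament 1) → ObtainableFromVertex T
  twin     : ∀ {n} {T : Tournament n} {T′ : Tournament (suc n)} (x : Fin n) →
             ObtainableFromVertex T → TwinExtension T x T′ → ObtainableFromVertex T′
  antitwin : ∀ {n} {T : Tournament n} {T′ : Tournament (suc n)} (x : Fin n) →
             ObtainableFromVertex T → AntitwinExtension T x T′ → ObtainableFromVertex T′

{-# OPTIONS --safe #-}

-- Being diamond-free is invariant under switching, i.e. reversing all arcs at a
-- vertex. Switching the out-neighbours of a vertex v of a diamond-free tournament
-- makes v a sink, and the other vertices then carry no 3-cycle: the result is a
-- transitive tournament. In it v and its predecessor are twins, so in the original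
-- tournament they are twins or antitwins. They form a two-element bijoin, and
-- removing v and recursing gives the construction from a single vertex.
-- Conversely, a non-trivial bijoin of a 4-vertex tournament has two vertices and
-- excludes a diamond; and if y is a twin or antitwin of x, no diamond contains both,
-- while one through y stays a diamond when y is replaced by x.

module Submission where

open import Defs
open import Data.Bool.Base using (Bool; true; false; not; _xor_)
open import Data.Bool.Properties using (not-involutive; not-injective; not-¬; ¬-not; not-distribˡ-xor; not-distribʳ-xor; xor-assoc; xor-comm; xor-annihilates-not)
  renaming (_≟_ to _≟ᵇ_)
open import Data.Bool.Solver using (module xor-∧-Solver)
open import Data.Empty using (⊥)
open import Data.Fin.Base using (Fin; zero; suc)
open import Data.Fin.Patterns using (0F; 1F; 2F; 3F)
open import Data.Fin.Properties using (_≟_; any?; injective⇒≤; suc-injective)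
open import Data.Fin.Subset as Subset using (Subset; ⁅_⁆; inside)
open import Data.Fin.Subset.Properties using (_∈?_; ∣⁅x⁆∣≡1; x∈⁅y⁆⇒x≡y; x∈⁅x⁆)
open import Data.Nat.Base using (ℕ; zero; suc; _≤_; z≤n; s≤s)
open import Data.Nat.Properties using (≤-refl; ≤-trans; 1+n≰n; n≤1+n)
open import Data.Product.Base using (∃; _×_; _,_; proj₁; proj₂)
open import Data.Sum.Base using (_⊎_; inj₁; inj₂)
open import Data.Vec.Base using ([]; _∷_; here; there)
open import Data.Vec.Relation.Unary.All using (All; []; _∷_)
open import Data.Vec.Relation.Unary.AllPairs using ([]; _∷_)
open import Data.Vec.Relation.Unary.Unique.Propositional using (Unique)
open import Data.Vec.Relation.Unary.Unique.Propositional.Properties using (lookup-injective)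
open import Function.Base using (_∘′_)
open import Function.Bundles using (_↣_; _⇔_; mk⇔; mk↣; Injection; Equivalence)
open import Function.Construct.Composition using (_⇔-∘_)
open import Function.Construct.Identity using (⇔-id)
open import Function.Construct.Symmetry using (⇔-sym)
open import Function.Definitions using (Injective)
open import Level using (0ℓ)
open import Relation.Binary.Consequences using (tri⇒asym; tri⇒irr; tri⇒dec<)
open import Relation.Binary.Core using (Rel)
open import Relation.Binary.Definitions using (Reflexive; Transitive; Total; tri<; tri≈; tri>; Decidable)
open import Relation.Binary.PropositionalEquality using (_≡_; _≢_; refl; sym; trans; cong; cong₂; subst; ≢-sym)
open import Relation.Nullary.Decidable using (Dec; does; proof; yes; no; ¬?; dec-true; dec-false; does-⇔; True; False; toWitness; toWitnessFalse)
open import Relation.Nullary.Negation using (¬_; contradiction)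
open import Relation.Nullary.Reflects using (Reflects; invert)

-- Boolean and finite-set preliminaries.

xor-cancelˡ : ∀ p {x y} → p xor x ≡ p xor y → x ≡ y
xor-cancelˡ true  = not-injective
xor-cancelˡ false eq = eq

xor-involutiveˡ : ∀ p x → p xor (p xor x) ≡ x
xor-involutiveˡ true  = not-involutive
xor-involutiveˡ false x = refl

not-xor : ∀ x y → not x xor y ≡ x xor not y
not-xor x y = trans (sym (not-distribˡ-xor x y)) (not-distribʳ-xor x y)

two-agree : ∀ (x y z : Bool) → x ≡ y ⊎ y ≡ z ⊎ z ≡ x
two-agree true  true  _     = inj₁ refl
two-agree false false _     = inj₁ refl
two-agree true  false true  = inj₂ (inj₂ refl)
two-agree true  false false = inj₂ (inj₁ refl)
two-agree false true  true  = inj₂ (inj₁ refl)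
two-agree false true  false = inj₂ (inj₂ refl)

total⇒reflexive : ∀ {A : Set} {R : Rel A 0ℓ} → Total R → Reflexive R
total⇒reflexive total {x} with total x x
... | inj₁ r = r
... | inj₂ r = r

minimum : ∀ {n} {R : Rel (Fin (suc n)) 0ℓ} → Transitive R → Total R → ∃ λ m → ∀ x → R m x
minimum {zero}  R-trans total = zero , λ { zero → total⇒reflexive total }
minimum {suc n} {R} R-trans total
  with m , least ← minimum {R = λ x y → R (suc x) (suc y)} R-trans (λ x y → total (suc x) (suc y))
  with total (suc m) zero
... | inj₁ m≤0 = suc m , λ { zero → m≤0 ; (suc x) → least x }
... | inj₂ 0≤m = zero  , λ { zero → total⇒reflexive total ; (suc x) → R-trans 0≤m (least x) }

-- Pigeonhole: if `w` were missed as well as `z`, prepending both to `f` would inject n + 2 elements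
-- into n + 1. Later it shows that every vertex other than the new one of an extension is old.
missed⇒≡ : ∀ {n} {f : Fin n → Fin (suc n)} {z} → Injective _≡_ _≡_ f → (∀ i → f i ≢ z) →
           ∀ {w} → w ≢ z → ∃ λ i → f i ≡ w
missed⇒≡ {n} {f} {z} f-inj f≢z {w} w≢z with any? (λ i → f i ≟ w)
... | yes hit = hit
... | no miss = contradiction (injective⇒≤ g-inj) 1+n≰n
  where
  g : Fin (suc (suc n)) → Fin (suc n)
  g zero          = z
  g (suc zero)    = w
  g (suc (suc i)) = f i

  g-inj : Injective _≡_ _≡_ g
  g-inj {zero}        {zero}        _  = refl
  g-inj {zero}        {suc zero}    eq = contradiction (sym eq) w≢z
  g-inj {zero}        {suc (suc j)} eq = contradiction (sym eq) (f≢z j)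
  g-inj {suc zero}    {zero}        eq = contradiction eq w≢z
  g-inj {suc zero}    {suc zero}    _  = refl
  g-inj {suc zero}    {suc (suc j)} eq = contradiction (j , sym eq) miss
  g-inj {suc (suc i)} {zero}        eq = contradiction eq (f≢z i)
  g-inj {suc (suc i)} {suc zero}    eq = contradiction (i , eq) miss
  g-inj {suc (suc i)} {suc (suc j)} eq = cong (λ k → suc (suc k)) (f-inj eq)

-- Arcs as signs over 𝔽₂.

module Signs {n} (T : Tournament n) where
  open Tournament T using (_⟶_; compare; H)

  _⟶?_ : Decidable _⟶_
  _⟶?_ = tri⇒dec< compare

  ⟶-asym : ∀ {u v} → u ⟶ v → ¬ v ⟶ u
  ⟶-asym = tri⇒asym compare

  ⟶⇒≢ : ∀ {u v} → u ⟶ v → u ≢ v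
  ⟶⇒≢ u⟶v u≡v = tri⇒irr compare u≡v u⟶v

  connex : ∀ {u v} → u ≢ v → ¬ u ⟶ v → v ⟶ u
  connex {u} {v} u≢v u↛v with compare u v
  ... | tri< u⟶v _ _ = contradiction u⟶v u↛v
  ... | tri≈ _ u≡v _ = contradiction u≡v u≢v
  ... | tri> _ _ v⟶u = v⟶u

  -- Arcs become elements of 𝔽₂, with `true` as 1, so that reversing an arc adds 1 and the arguments
  -- below are linear. The diagonal value is `false`, which is why `sgn-flip` asks for distinct
  -- vertices.
  sgn : Fin n → Fin n → Bool
  sgn u v = does (u ⟶? v)

  sgn-true : ∀ {u v} → u ⟶ v → sgn u v ≡ true
  sgn-true = dec-true (_ ⟶? _)

  sgn-false : ∀ {u v} → v ⟶ u → sgn u v ≡ false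
  sgn-false v⟶u = dec-false (_ ⟶? _) (⟶-asym v⟶u)

  true⇒⟶ : ∀ {u v} → sgn u v ≡ true → u ⟶ v
  true⇒⟶ {u} {v} eq = invert (subst (Reflects (u ⟶ v)) eq (proof (u ⟶? v)))

  false⇒⟵ : ∀ {u v} → u ≢ v → sgn u v ≡ false → v ⟶ u
  false⇒⟵ {u} {v} u≢v eq = connex u≢v (invert (subst (Reflects (u ⟶ v)) eq (proof (u ⟶? v))))

  sgn-flip : ∀ {u v} → u ≢ v → sgn v u ≡ not (sgn u v)
  sgn-flip u≢v = does-⇔ (mk⇔ ⟶-asym (connex u≢v)) (_ ⟶? _) (¬? (_ ⟶? _))

  H⇔sgn≡ : ∀ {u x y} → u ≢ x → u ≢ y → H u x y ⇔ sgn u x ≡ sgn u y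
  H⇔sgn≡ {u} {x} {y} u≢x u≢y = mk⇔ to (λ eq → from eq refl)
    where
    to : H u x y → sgn u x ≡ sgn u y
    to (inj₁ (u⟶x , u⟶y)) = trans (sgn-true u⟶x) (sym (sgn-true u⟶y))
    to (inj₂ (x⟶u , y⟶u)) = trans (sgn-false x⟶u) (sym (sgn-false y⟶u))

    from : ∀ {p} → sgn u x ≡ p → sgn u y ≡ p → H u x y
    from {true}  eq₁ eq₂ = inj₁ (true⇒⟶ eq₁ , true⇒⟶ eq₂)
    from {false} eq₁ eq₂ = inj₂ (false⇒⟵ u≢x eq₁ , false⇒⟵ u≢y eq₂)

  -- Diamonds and local transitivity.

  Diamond : Fin n → Fin n → Fin n → Fin n → Set
  Diamond a b c d = (a ⟶ b × b ⟶ c × c ⟶ a) ×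
                    ((d ⟶ a × d ⟶ b × d ⟶ c) ⊎ (a ⟶ d × b ⟶ d × c ⟶ d))

  NoDiamond : Set
  NoDiamond = ∀ {a b c d} → ¬ Diamond a b c d

  -- The centre is listed first, since the first vertex of `Crossed` is the one whose three arcs are
  -- compared.
  diamond-distinct : ∀ {a b c d} → Diamond a b c d → Unique (d ∷ a ∷ b ∷ c ∷ [])
  diamond-distinct ((ab , bc , ca) , centre) =
    spokes centre ∷ (⟶⇒≢ ab ∷ ≢-sym (⟶⇒≢ ca) ∷ []) ∷ (⟶⇒≢ bc ∷ []) ∷ [] ∷ []
    where
    spokes : ∀ {a b c d} → (d ⟶ a × d ⟶ b × d ⟶ c) ⊎ (a ⟶ d × b ⟶ d × c ⟶ d) →
             All (d ≢_) (a ∷ b ∷ c ∷ [])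
    spokes (inj₁ (da , db , dc)) = ⟶⇒≢ da ∷ ⟶⇒≢ db ∷ ⟶⇒≢ dc ∷ []
    spokes (inj₂ (ad , bd , cd)) = ≢-sym (⟶⇒≢ ad) ∷ ≢-sym (⟶⇒≢ bd) ∷ ≢-sym (⟶⇒≢ cd) ∷ []

  locallyTransitive⇒noDiamond : LocallyTransitive T → NoDiamond
  locallyTransitive⇒noDiamond lt {a} {b} {c} {d} ((ab , bc , ca) , inj₁ (da , db , dc)) =
    ⟶-asym ca (proj₁ (lt d) {a , da} {b , db} {c , dc} ab bc)
  locallyTransitive⇒noDiamond lt {a} {b} {c} {d} ((ab , bc , ca) , inj₂ (ad , bd , cd)) =
    ⟶-asym ca (proj₂ (lt d) {a , ad} {b , bd} {c , cd} ab bc)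

  -- Given a ⟶ b ⟶ c, trichotomy leaves two ways to miss a ⟶ c: a = c contradicts asymmetry, and c ⟶
  -- a closes a 3-cycle.
  no3Cycle⇒transitiveOn : ∀ {P : Fin n → Set} →
    (∀ {a b c} → P a → P b → P c → ¬ (a ⟶ b × b ⟶ c × c ⟶ a)) → Tournament.TransitiveOn T P
  no3Cycle⇒transitiveOn no3 {a , pa} {b , pb} {c , pc} ab bc with compare a c
  ... | tri< ac _ _   = ac
  ... | tri≈ _ refl _ = contradiction bc (⟶-asym ab)
  ... | tri> _ _ ca   = contradiction (ab , bc , ca) (no3 pa pb pc)

  noDiamond⇒locallyTransitive : NoDiamond → LocallyTransitive T
  noDiamond⇒locallyTransitive nd d =
    (λ {i} {j} {k} → no3Cycle⇒transitiveOn (λ da db dc cycle → nd (cycle , inj₁ (da , db , dc))) {i} {j} {k}) ,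
    (λ {i} {j} {k} → no3Cycle⇒transitiveOn (λ ad bd cd cycle → nd (cycle , inj₂ (ad , bd , cd))) {i} {j} {k})

  -- Diamonds as a linear condition on four vertices.

  -- The sums s(ab) + s(cd), s(ac) + s(db), s(ad) + s(bc) over 𝔽₂ agree exactly when
  -- a, b, c, d span a diamond. Switching a vertex (reversing its arcs) adds 1 to
  -- all three, and even permutations of a, b, c, d permute them.
  record Crossed (a b c d : Fin n) : Set where
    constructor crossed
    field
      distinct : Unique (a ∷ b ∷ c ∷ d ∷ [])
      ab∣cd≡ac∣db : sgn a b xor sgn c d ≡ sgn a c xor sgn d b
      ac∣db≡ad∣bc : sgn a c xor sgn d b ≡ sgn a d xor sgn b c

  CrossFree : Set
  CrossFree = ∀ {a b c d} → ¬ Crossed a b c d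

  rotate : ∀ {a b c d} → Crossed a b c d → Crossed a c d b
  rotate (crossed ((ab ∷ ac ∷ ad ∷ []) ∷ (bc ∷ bd ∷ []) ∷ (cd ∷ []) ∷ [] ∷ []) p q) =
    crossed ((ac ∷ ad ∷ ab ∷ []) ∷ (cd ∷ ≢-sym bc ∷ []) ∷ (≢-sym bd ∷ []) ∷ [] ∷ [])
            q (sym (trans p q))

  -- Each of the three sums keeps its value: either both of its arcs are reversed or its summands
  -- are swapped. Together with `rotate` this generates the even permutations, so any vertex can be
  -- moved to the front.
  exchange : ∀ {a b c d} → Crossed a b c d → Crossed b a d c
  exchange {a} {b} {c} {d}
    (crossed ((ab ∷ ac ∷ ad ∷ []) ∷ (bc ∷ bd ∷ []) ∷ (cd ∷ []) ∷ [] ∷ []) p q) =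
    crossed ((≢-sym ab ∷ bd ∷ bc ∷ []) ∷ (ad ∷ ac ∷ []) ∷ (≢-sym cd ∷ []) ∷ [] ∷ [])
            (trans (flip² ab cd) (trans p (sym ca))) (trans ca (trans q (xor-comm (sgn a d) _)))
    where
    flip² : ∀ {u v x y} → u ≢ v → x ≢ y → sgn v u xor sgn y x ≡ sgn u v xor sgn x y
    flip² {u} {v} {x} {y} u≢v x≢y =
      trans (cong₂ _xor_ (sgn-flip u≢v) (sgn-flip x≢y)) (xor-annihilates-not (sgn u v) (sgn x y))

    ca : sgn b d xor sgn c a ≡ sgn a c xor sgn d b
    ca = trans (flip² (≢-sym bd) ac) (xor-comm (sgn d b) _)

  halfTurn : ∀ {a b c d} → Crossed a b c d → Crossed c d a b
  halfTurn X = rotate (rotate (exchange (rotate X)))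

  -- With the centre first, each sum consists of a spoke and the opposite cycle arc. The spokes
  -- share one sign and the cycle arcs are all `true`.
  crossFree⇒noDiamond : CrossFree → NoDiamond
  crossFree⇒noDiamond cf D@((ab , bc , ca) , inj₁ (da , db , dc)) =
    cf (crossed (diamond-distinct D)
      (trans (cong₂ _xor_ (sgn-true da) (sgn-true bc)) (sym (cong₂ _xor_ (sgn-true db) (sgn-true ca))))
      (trans (cong₂ _xor_ (sgn-true db) (sgn-true ca)) (sym (cong₂ _xor_ (sgn-true dc) (sgn-true ab)))))
  crossFree⇒noDiamond cf D@((ab , bc , ca) , inj₂ (ad , bd , cd)) =
    cf (crossed (diamond-distinct D)
      (trans (cong₂ _xor_ (sgn-false ad) (sgn-true bc)) (sym (cong₂ _xor_ (sgn-false bd) (sgn-true ca))))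
      (trans (cong₂ _xor_ (sgn-false bd) (sgn-true ca)) (sym (cong₂ _xor_ (sgn-false cd) (sgn-true ab)))))

  module _ (nd : NoDiamond) where

    -- Cancelling the common sign at `a` leaves equal signs on bc, cd and db, so b, c, d form a
    -- 3-cycle with centre `a`.
    no-homogeneous-vertex : ∀ {a b c d} → Crossed a b c d → sgn a b ≡ sgn a c → sgn a c ≡ sgn a d → ⊥
    no-homogeneous-vertex {a} {b} {c} {d}
      (crossed ((a≢b ∷ a≢c ∷ a≢d ∷ []) ∷ (b≢c ∷ b≢d ∷ []) ∷ (c≢d ∷ []) ∷ [] ∷ []) p q) ab≡ac ac≡ad =
      cycle (sgn b c) refl (trans cd≡db db≡bc) db≡bc
      where
      cd≡db : sgn c d ≡ sgn d b
      cd≡db = xor-cancelˡ (sgn a b) (trans p (cong (_xor sgn d b) (sym ab≡ac)))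

      db≡bc : sgn d b ≡ sgn b c
      db≡bc = xor-cancelˡ (sgn a c) (trans q (cong (_xor sgn b c) (sym ac≡ad)))

      centre : ∀ r → sgn a b ≡ r → sgn a c ≡ r → sgn a d ≡ r →
               (a ⟶ b × a ⟶ c × a ⟶ d) ⊎ (b ⟶ a × c ⟶ a × d ⟶ a)
      centre true  ab ac ad = inj₁ (true⇒⟶ ab , true⇒⟶ ac , true⇒⟶ ad)
      centre false ab ac ad = inj₂ (false⇒⟵ a≢b ab , false⇒⟵ a≢c ac , false⇒⟵ a≢d ad)

      cycle : ∀ r → sgn b c ≡ r → sgn c d ≡ sgn b c → sgn d b ≡ sgn b c → ⊥
      cycle true  bc cd db = nd
        ( (true⇒⟶ bc , true⇒⟶ (trans cd bc) , true⇒⟶ (trans db bc))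
        , centre (sgn a c) ab≡ac refl (sym ac≡ad))
      -- Here the 3-cycle runs the other way, b ⟶ d ⟶ c ⟶ b, and the spokes are reordered to match.
      cycle false bc cd db with centre (sgn a c) ab≡ac refl (sym ac≡ad)
      ... | inj₁ (ab , ac , ad) = nd
        ( (false⇒⟵ (≢-sym b≢d) (trans db bc) , false⇒⟵ c≢d (trans cd bc) , false⇒⟵ b≢c bc)
        , inj₁ (ab , ad , ac))
      ... | inj₂ (ba , ca , da) = nd
        ( (false⇒⟵ (≢-sym b≢d) (trans db bc) , false⇒⟵ c≢d (trans cd bc) , false⇒⟵ b≢c bc)
        , inj₂ (ba , da , ca))

    -- One of a, b, c has equal signs towards the other three vertices. If `a` has not, then bc and
    -- db have opposite signs; this makes `b` such a vertex when ab and db agree, and `c` otherwise.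
    no-agreeing-pair : ∀ {a b c d} → Crossed a b c d → sgn a b ≢ sgn a c
    no-agreeing-pair {a} {b} {c} {d}
      X@(crossed ((a≢b ∷ a≢c ∷ a≢d ∷ []) ∷ (b≢c ∷ b≢d ∷ []) ∷ (c≢d ∷ []) ∷ [] ∷ []) p q) ab≡ac
      = cases (sgn a c ≟ᵇ sgn a d) (sgn a b ≟ᵇ sgn d b)
      where
      cd≡db : sgn c d ≡ sgn d b
      cd≡db = xor-cancelˡ (sgn a b) (trans p (cong (_xor sgn d b) (sym ab≡ac)))

      bc≡¬db : sgn a c ≢ sgn a d → sgn b c ≡ not (sgn d b)
      bc≡¬db ac≢ad = xor-cancelˡ (sgn a d)
        (trans (sym q) (trans (cong (_xor sgn d b) (¬-not ac≢ad)) (not-xor (sgn a d) (sgn d b))))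

      cases : Dec (sgn a c ≡ sgn a d) → Dec (sgn a b ≡ sgn d b) → ⊥
      cases (yes ac≡ad) _           = no-homogeneous-vertex X ab≡ac ac≡ad
      cases (no  ac≢ad) (yes ab≡db) = no-homogeneous-vertex (exchange X)
        (trans (sgn-flip a≢b) (trans (cong not ab≡db) (sym (sgn-flip (≢-sym b≢d)))))
        (trans (sgn-flip (≢-sym b≢d)) (sym (bc≡¬db ac≢ad)))
      cases (no  ac≢ad) (no  ab≢db) = no-homogeneous-vertex (exchange (rotate X))
        (trans ca≡db (sym cb≡db))
        (trans cb≡db (sym cd≡db))
        where
        ca≡db : sgn c a ≡ sgn d b
        ca≡db = trans (sgn-flip a≢c)
          (trans (cong not (trans (sym ab≡ac) (¬-not ab≢db))) (not-involutive _))

        cb≡db : sgn c b ≡ sgn d b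
        cb≡db = trans (sgn-flip b≢c) (trans (cong not (bc≡¬db ac≢ad)) (not-involutive _))

    -- Two of the three signs at `a` must agree, and a rotation makes them the first two.
    noDiamond⇒crossFree : CrossFree
    noDiamond⇒crossFree {a} {b} {c} {d} X with two-agree (sgn a b) (sgn a c) (sgn a d)
    ... | inj₁ ab≡ac        = no-agreeing-pair X ab≡ac
    ... | inj₂ (inj₁ ac≡ad) = no-agreeing-pair (rotate X) ac≡ad
    ... | inj₂ (inj₂ ad≡ab) = no-agreeing-pair (rotate (rotate X)) ad≡ab

  -- Twins, antitwins and bijoins against crossed quadruples.

  -- Twins for ε = false, antitwins for ε = true.
  Alike : Bool → Fin n → Fin n → Set
  Alike ε x y = ∀ {w} → w ≢ x → w ≢ y → sgn x w ≡ ε xor sgn y w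

  alike-sym : ∀ {ε x y} → Alike ε x y → Alike ε y x
  alike-sym {ε} alike w≢y w≢x =
    trans (sym (xor-involutiveˡ ε _)) (cong (ε xor_) (sym (alike w≢x w≢y)))

  twins⇒alike : ∀ {x y} → Twins T x y → Alike false x y
  twins⇒alike (x⊆y , y⊆x) w≢x w≢y = does-⇔
    (mk⇔ (λ xw → proj₁ (x⊆y (xw , ≢-sym w≢y))) (λ yw → proj₁ (y⊆x (yw , ≢-sym w≢x))))
    (_ ⟶? _) (_ ⟶? _)

  antitwins⇒alike : ∀ {x y} → Antitwins T x y → Alike true x y
  antitwins⇒alike (x⊆y , y⊆x) w≢x w≢y = trans
    (does-⇔ (mk⇔ (λ xw → proj₁ (x⊆y (xw , ≢-sym w≢y))) (λ wy → proj₁ (y⊆x (wy , ≢-sym w≢x))))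
      (_ ⟶? _) (_ ⟶? _))
    (sgn-flip (≢-sym w≢y))

  alike⇒twins : ∀ {x y} → Alike false x y → Twins T x y
  alike⇒twins {x} {y} alike =
    (λ (xw , y≢w) → true⇒⟶ (trans (sym (alike (≢-sym (⟶⇒≢ xw)) (≢-sym y≢w))) (sgn-true xw)) , ⟶⇒≢ xw) ,
    (λ (yw , x≢w) → true⇒⟶ (trans (alike (≢-sym x≢w) (≢-sym (⟶⇒≢ yw))) (sgn-true yw)) , ⟶⇒≢ yw)

  alike⇒antitwins : ∀ {x y} → Alike true x y → Antitwins T x y
  alike⇒antitwins {x} {y} alike =
    (λ (xw , y≢w) →
      false⇒⟵ y≢w (not-injective (trans (sym (alike (≢-sym (⟶⇒≢ xw)) (≢-sym y≢w))) (sgn-true xw))) ,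
      ⟶⇒≢ xw) ,
    (λ (wy , x≢w) →
      true⇒⟶ (trans (alike (≢-sym x≢w) (⟶⇒≢ wy)) (cong not (sgn-false wy))) , ≢-sym (⟶⇒≢ wy))

  -- Both s(xc) + s(dy) and s(xd) + s(yc) reduce to ε + s(yc) + s(yd), except that the reversed arc
  -- dy adds 1 to the former.
  alike-not-crossed : ∀ {ε x y c d} → Alike ε x y → ¬ Crossed x y c d
  alike-not-crossed {ε} {x} {y} {c} {d} alike
    (crossed ((x≢y ∷ x≢c ∷ x≢d ∷ []) ∷ (y≢c ∷ y≢d ∷ []) ∷ _) _ q) =
    not-¬ q (trans
      (cong₂ _xor_ (alike (≢-sym x≢c) (≢-sym y≢c)) (sgn-flip y≢d))
      (trans
        (solve 3 (λ e p r → (e :+ p) :+ (con true :+ r) := con true :+ ((e :+ r) :+ p)) refl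
          ε (sgn y c) (sgn y d))
        (cong (λ z → not (z xor sgn y c)) (sym (alike (≢-sym x≢d) (≢-sym y≢d))))))
    where open xor-∧-Solver

  -- Replacing `y` by `x` adds ε to all three sums, so their equality survives.
  alike-crossed : ∀ {ε x y b c d} → Alike ε x y → x ≢ b → x ≢ c → x ≢ d →
                  Crossed y b c d → Crossed x b c d
  alike-crossed {ε} {x} {y} {b} {c} {d} alike x≢b x≢c x≢d
    (crossed ((y≢b ∷ y≢c ∷ y≢d ∷ []) ∷ bcd) p q) =
    crossed ((x≢b ∷ x≢c ∷ x≢d ∷ []) ∷ bcd)
      (switch (alike (≢-sym x≢b) (≢-sym y≢b)) (alike (≢-sym x≢c) (≢-sym y≢c)) p)
      (switch (alike (≢-sym x≢c) (≢-sym y≢c)) (alike (≢-sym x≢d) (≢-sym y≢d)) q)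
    where
    switch : ∀ {p p′ q q′ r s} → p′ ≡ ε xor p → q′ ≡ ε xor q → p xor r ≡ q xor s →
             p′ xor r ≡ q′ xor s
    switch {p} {q = q} {r = r} {s} refl refl eq =
      trans (xor-assoc ε p r) (trans (cong (ε xor_) eq) (sym (xor-assoc ε q s)))

  -- The hypothesis says s(ac) + s(ad) = s(bc) + s(bd). Equality of the last two sums gives s(ac) +
  -- s(ad) = s(db) + s(bc), which is off by 1 because db is reversed.
  bijoin-split-not-crossed : ∀ {a b c d} → H a c d ⇔ H b c d → ¬ Crossed a b c d
  bijoin-split-not-crossed {a} {b} {c} {d} split
    (crossed ((a≢b ∷ a≢c ∷ a≢d ∷ []) ∷ (b≢c ∷ b≢d ∷ []) ∷ _) _ q) = cases (sgn a c ≟ᵇ sgn a d)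
    where
    agree : sgn a c ≡ sgn a d ⇔ sgn b c ≡ sgn b d
    agree = H⇔sgn≡ b≢c b≢d ⇔-∘ (split ⇔-∘ ⇔-sym (H⇔sgn≡ a≢c a≢d))

    q′ : sgn a c xor not (sgn b d) ≡ sgn a d xor sgn b c
    q′ = trans (cong (sgn a c xor_) (sym (sgn-flip b≢d))) q

    cases : Dec (sgn a c ≡ sgn a d) → ⊥
    cases (yes ac≡ad) = not-¬ (Equivalence.to agree ac≡ad)
      (sym (xor-cancelˡ (sgn a c) (trans q′ (cong (_xor sgn b c) (sym ac≡ad)))))
    cases (no ac≢ad) = ac≢ad (Equivalence.from agree (sym (xor-cancelˡ (sgn a d)
      (trans (sym (xor-annihilates-not (sgn a d) (sgn b d)))
        (trans (cong (_xor not (sgn b d)) (sym (¬-not ac≢ad))) q′)))))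

  -- The linear order obtained by switching.

  -- For distinct x, y other than v: the arc y ⟶ x after the out-neighbours of v are switched.
  Precedes : Fin n → Rel (Fin n) 0ℓ
  Precedes v x y = x ≢ y → sgn v x xor sgn x y ≡ sgn v y

  -- Swapping x and y adds 1 to s(vx) + s(xy) + s(vy), so for distinct x, y exactly one of the two
  -- equations holds. For x = y the relation is vacuous.
  precedes-total : ∀ v → Total (Precedes v)
  precedes-total v x y with x ≟ y | sgn v x xor sgn x y ≟ᵇ sgn v y
  ... | yes x≡y | _      = inj₁ (contradiction x≡y)
  ... | no  _   | yes eq = inj₁ (λ _ → eq)
  ... | no  x≢y | no neq = inj₂ (λ _ →
    trans (cong₂ _xor_ (sym (trans (cong not (¬-not neq)) (not-involutive _))) (sgn-flip x≢y))
      (solve 2 (λ p s → (con true :+ (p :+ s)) :+ (con true :+ s) := p) refl (sgn v x) (sgn x y)))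
    where open xor-∧-Solver

  -- Failure would give z before x, a 3-cycle in the switched tournament. Eliminating signs from its
  -- three equations shows that v, x, y, z are crossed.
  precedes-trans : CrossFree → ∀ {v x y z} → v ≢ x → v ≢ y → v ≢ z →
                   Precedes v x y → Precedes v y z → Precedes v x z
  precedes-trans cf {v} {x} {y} {z} v≢x v≢y v≢z x≺y y≺z x≢z
    with x ≟ y | y ≟ z | precedes-total v x z
  ... | yes refl | _        | _        = y≺z x≢z
  ... | no _     | yes refl | _        = x≺y x≢z
  ... | no _     | no _     | inj₁ x≺z = x≺z x≢z
  ... | no x≢y   | no y≢z   | inj₂ z≺x = contradiction
    (crossed ((v≢x ∷ v≢y ∷ v≢z ∷ []) ∷ (x≢y ∷ x≢z ∷ []) ∷ (y≢z ∷ []) ∷ [] ∷ [])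
      (closed (sgn v y) (sgn y z) (sgn z x) (y≺z y≢z) (z≺x (≢-sym x≢z)))
      (closed (sgn v z) (sgn z x) (sgn x y) (z≺x (≢-sym x≢z)) (x≺y x≢y)))
    cf
    where
    open xor-∧-Solver
    closed : ∀ {p r} q s t → q xor s ≡ r → r xor t ≡ p → p xor s ≡ q xor t
    closed q s t refl refl =
      solve 3 (λ q s t → ((q :+ s) :+ t) :+ s := q :+ t) refl q s t

open Signs

-- Existence of twins or antitwins, and the bijoins they form.

module _ {n} (T : Tournament (suc (suc n))) where

  exists-alike : CrossFree T → ∃ λ m → ∃ λ ε → Alike T ε (suc m) zero
  exists-alike cf
    with m , least ← minimum {R = λ x y → Precedes T zero (suc x) (suc y)}
      (precedes-trans T cf (λ ()) (λ ()) (λ ()))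
      (λ x y → precedes-total T zero (suc x) (suc y))
    -- Minimality reads s(0m) + s(mw) = s(0w) for the chosen vertex, so ε is the sign of the arc
    -- from `zero` to it: twins if that vertex dominates `zero`, antitwins otherwise.
    = m , sgn T zero (suc m) , λ
      { {zero}  _   0≢0 → contradiction refl 0≢0
      ; {suc w} w≢m _   → trans (sym (xor-involutiveˡ (sgn T zero (suc m)) _))
                                (cong (sgn T zero (suc m) xor_) (least w (≢-sym w≢m))) }

  -- The set is the pair of `zero` and `suc m`. Adding ε to both signs does not change whether they
  -- agree, so homogeneity at either vertex is compared with agreement at `zero`.
  alike⇒bijoin : ∀ {m ε} → Alike T ε (suc m) zero → IsBijoin T (inside ∷ ⁅ m ⁆)
  alike⇒bijoin {m} {ε} alike {x = x} {y} u∈U u′∈U x∉U y∉U = ⇔-sym (split u′∈U) ⇔-∘ split u∈U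
    where
    open Tournament T using (H)

    0≢ : ∀ {w} → w Subset.∉ inside ∷ ⁅ m ⁆ → zero ≢ w
    0≢ 0∉U refl = 0∉U here

    m≢ : ∀ {w} → w Subset.∉ inside ∷ ⁅ m ⁆ → suc m ≢ w
    m≢ m∉U refl = m∉U (there (x∈⁅x⁆ m))

    agree : ∀ {w} → w Subset.∉ inside ∷ ⁅ m ⁆ → sgn T (suc m) w ≡ ε xor sgn T zero w
    agree w∉U = alike (≢-sym (m≢ w∉U)) (≢-sym (0≢ w∉U))

    split : ∀ {u} → u Subset.∈ inside ∷ ⁅ m ⁆ → H u x y ⇔ sgn T zero x ≡ sgn T zero y
    split here = H⇔sgn≡ T (0≢ x∉U) (0≢ y∉U)
    split (there u∈⁅m⁆) with refl ← x∈⁅y⁆⇒x≡y m u∈⁅m⁆ =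
      mk⇔ (λ mx≡my → xor-cancelˡ ε (trans (sym (agree x∉U)) (trans mx≡my (agree y∉U))))
          (λ 0x≡0y → trans (agree x∉U) (trans (cong (ε xor_) 0x≡0y) (sym (agree y∉U))))
      ⇔-∘ H⇔sgn≡ T (m≢ x∉U) (m≢ y∉U)

  alike⇒hasNontrivialBijoin : ∀ {m ε} → 2 ≤ n → Alike T ε (suc m) zero → HasNontrivialBijoin T
  alike⇒hasNontrivialBijoin {m} {ε} 2≤n alike = inside ∷ ⁅ m ⁆ , alike⇒bijoin {ε = ε} alike , nontrivial
    where
    nontrivial : ¬ Trivial (inside ∷ ⁅ m ⁆)
    nontrivial trivial rewrite ∣⁅x⁆∣≡1 m with trivial
    ... | inj₁ (s≤s ())
    -- The pair has 2 of the n + 2 vertices; n + 2 ≤ 3 would contradict 2 ≤ n.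
    ... | inj₂ (s≤s (s≤s n≤1)) = 1+n≰n (≤-trans 2≤n n≤1)

-- Consequences of diamond-freeness.

noDiamond⇒totallyDecomposable : ∀ {n} (T : Tournament n) → NoDiamond T → TotallyDecomposable T
noDiamond⇒totallyDecomposable T nd (s≤s (s≤s 2≤k)) ι
  with m , ε , alike ← exists-alike (induced T ι)
                         -- Arcs of `induced T ι` unfold to arcs of `T` between the images, so `nd`
                         -- applies as it stands.
                         (noDiamond⇒crossFree (induced T ι) nd)
  = alike⇒hasNontrivialBijoin (induced T ι) {ε = ε} 2≤k alike

noDiamond⇒obtainable : ∀ {n} (T : Tournament (suc n)) → NoDiamond T → ObtainableFromVertex T
noDiamond⇒obtainable {zero}  T nd = single T
noDiamond⇒obtainable {suc n} T nd with exists-alike T (noDiamond⇒crossFree T nd)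
... | m , ε , alike = extend ε alike
  where
  T₀ : Tournament (suc n)
  T₀ = induced T (mk↣ suc-injective)

  extension : OneVertexExtension T₀ T
  extension = record
    { embedding = mk↣ suc-injective ; new = zero ; new-fresh = λ v () ; arcs = λ u v → ⇔-id _ }

  obtainable₀ : ObtainableFromVertex T₀
  obtainable₀ = noDiamond⇒obtainable T₀ nd

  extend : ∀ ε → Alike T ε (suc m) zero → ObtainableFromVertex T
  extend false alike = twin m obtainable₀ (extension , alike⇒twins T alike)
  extend true  alike = antitwin m obtainable₀ (extension , alike⇒antitwins T alike)

-- Passing between embedded and internal diamonds; decomposability.

enumerate : ∀ {n} {a b c d : Fin n} → Unique (a ∷ b ∷ c ∷ d ∷ []) → Fin 4 ↣ Fin n
enumerate distinct = mk↣ (lookup-injective distinct _ _)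

diamondFree⇒noDiamond : ∀ {n} (T : Tournament n) → DiamondFree T → NoDiamond T
diamondFree⇒noDiamond T df D@(cycle , centre) =
  -- The centre heads the enumeration, so it has index `0F` and the cycle has indices `1F`, `2F`,
  -- `3F`.
  df (enumerate (diamond-distinct T D)) (1F , 2F , 3F , 0F , cycle , centre)

noDiamond⇒diamondFree : ∀ {n} (T : Tournament n) → NoDiamond T → DiamondFree T
noDiamond⇒diamondFree T nd ι (a , b , c , d , D) = nd D

-- Four crossed vertices span a tournament whose non-trivial bijoins would have exactly two
-- elements. An even permutation moves any such pair to the front, where `bijoin-split-not-crossed`
-- applies.
totallyDecomposable⇒crossFree : ∀ {n} (T : Tournament n) → TotallyDecomposable T → CrossFree T
totallyDecomposable⇒crossFree T td X@(crossed distinct _ _) =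
  let U , bijoin , nontrivial = td ≤-refl ι in cases U bijoin nontrivial
  where
  ι : Fin 4 ↣ Fin _
  ι = enumerate distinct

  open Injection ι using (to)

  refute : ∀ {U : Subset 4} i j k l
    {_ : True (i ∈? U)} {_ : True (j ∈? U)} {_ : False (k ∈? U)} {_ : False (l ∈? U)} →
    Crossed T (to i) (to j) (to k) (to l) → ¬ IsBijoin (induced T ι) U
  refute i j k l {i∈U} {j∈U} {k∉U} {l∉U} X bijoin = bijoin-split-not-crossed T
    (bijoin (toWitness i∈U) (toWitness j∈U) (toWitnessFalse k∉U) (toWitnessFalse l∉U)) X

  cases : (U : Subset 4) → IsBijoin (induced T ι) U → ¬ ¬ Trivial U
  -- The six pairs. Parity fixes the order within the permuted quadruple, hence arrangements such as
  -- `3F 1F 0F 2F`.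
  cases (true  ∷ true  ∷ false ∷ false ∷ []) β _ = refute 0F 1F 2F 3F X β
  cases (true  ∷ false ∷ true  ∷ false ∷ []) β _ = refute 0F 2F 3F 1F (rotate T X) β
  cases (true  ∷ false ∷ false ∷ true  ∷ []) β _ = refute 0F 3F 1F 2F (rotate T (rotate T X)) β
  cases (false ∷ false ∷ true  ∷ true  ∷ []) β _ = refute 2F 3F 0F 1F (halfTurn T X) β
  cases (false ∷ true  ∷ false ∷ true  ∷ []) β _ = refute 3F 1F 0F 2F (halfTurn T (rotate T X)) β
  cases (false ∷ true  ∷ true  ∷ false ∷ []) β _ = refute 1F 2F 0F 3F (halfTurn T (rotate T (rotate T X))) β
  -- All remaining subsets have at most one or at least three elements.
  cases (false ∷ false ∷ false ∷ false ∷ []) _ ν = ν (inj₁ z≤n)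
  cases (true  ∷ false ∷ false ∷ false ∷ []) _ ν = ν (inj₁ ≤-refl)
  cases (false ∷ true  ∷ false ∷ false ∷ []) _ ν = ν (inj₁ ≤-refl)
  cases (false ∷ false ∷ true  ∷ false ∷ []) _ ν = ν (inj₁ ≤-refl)
  cases (false ∷ false ∷ false ∷ true  ∷ []) _ ν = ν (inj₁ ≤-refl)
  cases (false ∷ true  ∷ true  ∷ true  ∷ []) _ ν = ν (inj₂ ≤-refl)
  cases (true  ∷ false ∷ true  ∷ true  ∷ []) _ ν = ν (inj₂ ≤-refl)
  cases (true  ∷ true  ∷ false ∷ true  ∷ []) _ ν = ν (inj₂ ≤-refl)
  cases (true  ∷ true  ∷ true  ∷ false ∷ []) _ ν = ν (inj₂ ≤-refl)
  cases (true  ∷ true  ∷ true  ∷ true  ∷ []) _ ν = ν (inj₂ (n≤1+n 4))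

-- Twin- and antitwin-extensions preserve cross-freeness.

module _ {n} {T : Tournament n} {T′ : Tournament (suc n)} (E : OneVertexExtension T T′) where
  open OneVertexExtension E using (embedding; new-fresh; arcs)

  old-injective : Injective _≡_ _≡_ (old E)
  old-injective = Injection.injective embedding

  sgn-old : ∀ u v → sgn T′ (old E u) (old E v) ≡ sgn T u v
  sgn-old u v = does-⇔ (⇔-sym (arcs u v)) (_⟶?_ T′ _ _) (_⟶?_ T u v)

  crossed-old : ∀ {a b c d} → Crossed T′ (old E a) (old E b) (old E c) (old E d) → Crossed T a b c d
  crossed-old {a} {b} {c} {d} (crossed ((ab ∷ ac ∷ ad ∷ []) ∷ (bc ∷ bd ∷ []) ∷ (cd ∷ []) ∷ [] ∷ []) p q) =
    crossed ((old⁻ ab ∷ old⁻ ac ∷ old⁻ ad ∷ []) ∷ (old⁻ bc ∷ old⁻ bd ∷ []) ∷ (old⁻ cd ∷ []) ∷ [] ∷ [])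
      (trans (sym (cong₂ _xor_ (sgn-old a b) (sgn-old c d)))
        (trans p (cong₂ _xor_ (sgn-old a c) (sgn-old d b))))
      (trans (sym (cong₂ _xor_ (sgn-old a c) (sgn-old d b)))
        (trans q (cong₂ _xor_ (sgn-old a d) (sgn-old b c))))
    where
    old⁻ : ∀ {u v} → old E u ≢ old E v → u ≢ v
    old⁻ u≢v u≡v = u≢v (cong (old E) u≡v)

  module _ (cf : CrossFree T) where

    no-crossed-old : ∀ {a b c d} → a ≢ new E → b ≢ new E → c ≢ new E → d ≢ new E → ¬ Crossed T′ a b c d
    no-crossed-old a≢ b≢ c≢ d≢ X
      with _ , refl ← missed⇒≡ old-injective new-fresh a≢
         | _ , refl ← missed⇒≡ old-injective new-fresh b≢
         | _ , refl ← missed⇒≡ old-injective new-fresh c≢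
         | _ , refl ← missed⇒≡ old-injective new-fresh d≢
      = cf (crossed-old X)

    module _ {x ε} (alike : Alike T′ ε (old E x) (new E)) where

      -- If the quadruple also contains `old E x`, a rotation puts the alike pair first, which is
      -- impossible. Otherwise `old E x` replaces the new vertex and yields a crossed quadruple of
      -- old vertices.
      no-crossed-new : ∀ {b c d} → ¬ Crossed T′ (new E) b c d
      no-crossed-new {b} {c} {d} X@(crossed ((n≢b ∷ n≢c ∷ n≢d ∷ []) ∷ _) _ _)
        with old E x ≟ b | old E x ≟ c | old E x ≟ d
      ... | yes refl | _        | _        =
        alike-not-crossed T′ {ε} (alike-sym T′ {ε} alike) X
      ... | no _     | yes refl | _        =
        alike-not-crossed T′ {ε} (alike-sym T′ {ε} alike) (rotate T′ X)
      ... | no _     | no _     | yes refl =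
        alike-not-crossed T′ {ε} (alike-sym T′ {ε} alike) (rotate T′ (rotate T′ X))
      ... | no x≢b   | no x≢c   | no x≢d   =
        no-crossed-old (new-fresh x) (≢-sym n≢b) (≢-sym n≢c) (≢-sym n≢d)
          (alike-crossed T′ {ε} alike x≢b x≢c x≢d X)

      crossFree-extension : CrossFree T′
      crossFree-extension {a} {b} {c} {d} X with a ≟ new E | b ≟ new E | c ≟ new E | d ≟ new E
      -- Wherever the new vertex occurs, an even permutation brings it to the front.
      ... | yes refl | _        | _        | _        = no-crossed-new X
      ... | no _     | yes refl | _        | _        = no-crossed-new (exchange T′ X)
      ... | no _     | no _     | yes refl | _        = no-crossed-new (halfTurn T′ X)
      ... | no _     | no _     | no _     | yes refl = no-crossed-new (halfTurn T′ (rotate T′ X))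
      ... | no a≢    | no b≢    | no c≢    | no d≢    = no-crossed-old a≢ b≢ c≢ d≢ X

obtainable⇒crossFree : ∀ {n} {T : Tournament n} → ObtainableFromVertex T → CrossFree T
obtainable⇒crossFree (single T) {0F} {0F} (crossed ((0≢0 ∷ _) ∷ _) _ _) = 0≢0 refl
obtainable⇒crossFree (twin {T′ = T′} x ob (E , twins)) =
  crossFree-extension E (obtainable⇒crossFree ob) {ε = false} (twins⇒alike T′ twins)
obtainable⇒crossFree (antitwin {T′ = T′} x ob (E , antitwins)) =
  crossFree-extension E (obtainable⇒crossFree ob) {ε = true} (antitwins⇒alike T′ antitwins)

theorem7 : (n : ℕ) (T : Tournament (suc n)) →
    (DiamondFree T ⇔ LocallyTransitive T) ×
    (LocallyTransitive T ⇔ TotallyDecomposable T) ×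
    (TotallyDecomposable T ⇔ ObtainableFromVertex T)
theorem7 n T =
  -- Every implication is routed through `NoDiamond`; decomposable and obtainable tournaments reach
  -- it by way of `CrossFree`.
  mk⇔ (noDiamond⇒locallyTransitive T ∘′ diamondFree⇒noDiamond T)
      (noDiamond⇒diamondFree T ∘′ locallyTransitive⇒noDiamond T) ,
  mk⇔ (noDiamond⇒totallyDecomposable T ∘′ locallyTransitive⇒noDiamond T)
      (noDiamond⇒locallyTransitive T ∘′ totallyDecomposable⇒noDiamond) ,
  mk⇔ (noDiamond⇒obtainable T ∘′ totallyDecomposable⇒noDiamond)
      (λ ob → noDiamond⇒totallyDecomposable T (crossFree⇒noDiamond T (obtainable⇒crossFree ob)))
  where
  totallyDecomposable⇒noDiamond : TotallyDecomposable T → NoDiamond T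
  totallyDecomposable⇒noDiamond td = crossFree⇒noDiamond T (totallyDecomposable⇒crossFree T td)
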